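{- Let $\kappa$ be a regular uncountable cardinal, $F$ a free filter on $\omega$, and $\mathbb{P}$ a finite support product of posets such that every finite subproduct is $\kappa$-$F$-Knaster. Then $\mathbb{P}$ is $\kappa$-$F$-Knaster. In particular, when $F$ is an ultrafilter, any finite support product of $\kappa$-$F$-Knaster posets is $\kappa$-$F$-Knaster; likewise any finite support product of $\kappa$-uf-Knaster posets is $\kappa$-uf-Knaster.
   Context: A filter $F$ on $\omega$ is free if it contains all cofinite subsets; $F^+$ is the family of sets meeting every member of $F$. For a poset $\mathbb{P}$ and $\bar p=\langle p_n:n<\omega\rangle$ in $\mathbb{P}$, $\dot W(\bar p)$ names $\{n:p_n\in\dot G\}$. $Q\subseteq\mathbb{P}$ is $F$-linked if for every sequence $\bar p$ in $Q$ some $q\in\mathbb{P}$ forces $\dot W(\bar p)\in F^+$; uf-linked if it is $D$-linked for every non-principal ultrafilter $D$ on $\omega$. $\mathbb{P}$ is $\kappa$-$F$-Knaster (resp. $\kappa$-uf-Knaster) if every subset of size $\kappa$ contains an $F$-linked (resp. uf-linked) subset of size $\kappa$. -}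

module Defs where

open import Data.Empty using (⊥-elim)
open import Data.List using ([])
open import Data.List.Membership.Propositional using () renaming (_∈_ to _∈ₗ_)
open import Data.Nat using (ℕ)
open import Data.Product using (Σ; ∃-syntax; _×_; _,_; proj₁)
open import Data.Sum using (_⊎_)
open import Function.Bundles using (Bijection; _↣_; _⇔_)
open import Induction.WellFounded using (WellFounded)
open import Level using (Level; 0ℓ; _⊔_; Lift) renaming (suc to lsuc)
open import Relation.Binary.Bundles using (Setoid; Preorder)
open import Relation.Binary.Core using (Rel)
import Relation.Binary.Construct.On as On
open import Relation.Binary.Definitions using (Maximum; _Respects_)
open import Relation.Binary.PropositionalEquality using (_≡_; setoid)
open import Relation.Binary.Structures using (IsStrictTotalOrder)
open import Relation.Nullary using (¬_)
open import Relation.Unary using (Pred; _∈_; _∉_; _⊆_; _∩_; ∁; U; ∅)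

private
  variable
    ℓ i : Level

Finite : {A : Set ℓ} → ∀ {p} → Pred A p → Set (ℓ ⊔ p)
Finite {A = A} X = ∃[ xs ] (∀ {x : A} → x ∈ X → x ∈ₗ xs)

-- Proofs of membership are ignored when comparing elements of a subset.
SubsetSetoid : (S : Setoid ℓ ℓ) → Pred (Setoid.Carrier S) ℓ → Setoid ℓ ℓ
SubsetSetoid S A = On.setoid S (proj₁ {B = A})

-- A cardinal is an initial ordinal: a well-ordered type that is not
-- equinumerous with any of its proper initial segments.
record Cardinal (ℓ : Level) : Set (lsuc ℓ) where
  infix 4 _<_
  field
    Carrier            : Set ℓ
    _<_                : Rel Carrier ℓ
    isStrictTotalOrder : IsStrictTotalOrder _≡_ _<_
    wellFounded        : WellFounded _<_
    initial            : ∀ α → ¬ Bijection (setoid Carrier) (SubsetSetoid (setoid Carrier) (_< α))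

-- cof(κ) = κ: no function from some α < κ to κ is cofinal. Such a function
-- is given here by a total function on κ, of which only the values below α
-- are used. (Conventions for finite κ differ; uncountability excludes them.)
Regular : Cardinal ℓ → Set ℓ
Regular κ = ∀ (α : Carrier) (f : Carrier → Carrier) → ∃[ β ] (∀ γ → γ < α → f γ < β)
  where open Cardinal κ

Uncountable : Cardinal ℓ → Set ℓ
Uncountable κ = ¬ (Cardinal.Carrier κ ↣ ℕ)

HasSize : (S : Setoid ℓ ℓ) → Pred (Setoid.Carrier S) ℓ → Cardinal ℓ → Set ℓ
HasSize S A κ = Bijection (setoid (Cardinal.Carrier κ)) (SubsetSetoid S A)

record Filter : Set₂ where
  field
    Member  : Pred (Pred ℕ 0ℓ) 0ℓ
    whole   : U ∈ Member
    proper  : ∅ ∉ Member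
    upward  : ∀ {a b} → a ∈ Member → a ⊆ b → b ∈ Member
    meet    : ∀ {a b} → a ∈ Member → b ∈ Member → (a ∩ b) ∈ Member

open Filter using (Member)

Free : Filter → Set₁
Free F = ∀ a → Finite (∁ a) → a ∈ Member F

IsUltrafilter : Filter → Set₁
IsUltrafilter F = ∀ a → a ∈ Member F ⊎ ∁ a ∈ Member F

Principal : Filter → Set₁
Principal F = ∃[ n ] (∀ a → a ∈ Member F ⇔ n ∈ a)

-- A poset in the sense of forcing: a preorder with a designated largest
-- element. Partial orders are the instances in which x ≲ y and y ≲ x give
-- x ≈ y.
record ForcingPoset (ℓ : Level) : Set (lsuc ℓ) where
  field
    preorder : Preorder ℓ ℓ ℓ
  open Preorder preorder public
  field
    𝟙       : Carrier
    maximum : Maximum _≲_ 𝟙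

  setoid≈ : Setoid ℓ ℓ
  setoid≈ = Eq.setoid

-- The fragment of the forcing language used for Ẇ(p̄) ∈ F⁺: atomic formulas
-- "p ∈ Ġ", with conjunctions and disjunctions over index sets in the
-- ground model.
data Formula (C : Set ℓ) : Set (ℓ ⊔ lsuc (lsuc 0ℓ)) where
  _∈Ġ : C → Formula C
  ⋀   : {A : Set₁} → (A → Formula C) → Formula C
  ⋁   : {A : Set} → (A → Formula C) → Formula C

module Forcing (P : ForcingPoset ℓ) where
  open ForcingPoset P

  DenseBelow : ∀ {a} → Carrier → Pred Carrier a → Set (ℓ ⊔ a)
  DenseBelow p D = ∀ q → q ≲ p → ∃[ r ] (r ≲ q × r ∈ D)

  infix 4 _⊩_
  _⊩_ : Carrier → Formula Carrier → Set (ℓ ⊔ lsuc 0ℓ)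
  p ⊩ (x ∈Ġ)  = Lift (lsuc 0ℓ) (DenseBelow p (_≲ x))
  p ⊩ ⋀ {A} φ = (a : A) → p ⊩ φ a
  p ⊩ ⋁ {A} φ = DenseBelow p (λ r → Σ A λ a → r ⊩ φ a)

  -- A name for a subset of ω, given by the formulas "n ∈ Ẋ".
  Name : Set (ℓ ⊔ lsuc (lsuc 0ℓ))
  Name = ℕ → Formula Carrier

  Ẇ : (ℕ → Carrier) → Name
  Ẇ p̄ n = p̄ n ∈Ġ

  -- "Ẋ meets every member of F".
  infix 5 _∈̇_⁺
  _∈̇_⁺ : Name → Filter → Formula Carrier
  Ẋ ∈̇ F ⁺ = ⋀ {A = Σ (Pred ℕ 0ℓ) (Member F)} λ (a , _) → ⋁ {A = Σ ℕ a} λ (n , _) → Ẋ n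

  Linked : Filter → Pred Carrier ℓ → Set (ℓ ⊔ lsuc 0ℓ)
  Linked F Q = ∀ (p̄ : ℕ → Carrier) → (∀ n → p̄ n ∈ Q) → ∃[ q ] (q ⊩ Ẇ p̄ ∈̇ F ⁺)

  UfLinked : Pred Carrier ℓ → Set (ℓ ⊔ lsuc (lsuc 0ℓ))
  UfLinked Q = ∀ (D : Filter) → IsUltrafilter D → ¬ Principal D → Linked D Q

Knaster : Cardinal ℓ → Filter → ForcingPoset ℓ → Set (lsuc ℓ)
Knaster {ℓ} κ F P =
  ∀ (A : Pred Carrier ℓ) → A Respects _≈_ → HasSize setoid≈ A κ →
  Σ (Pred Carrier ℓ) λ B → B Respects _≈_ × B ⊆ A × HasSize setoid≈ B κ × Linked F B
  where open ForcingPoset P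
        open Forcing P

UfKnaster : Cardinal ℓ → ForcingPoset ℓ → Set (lsuc ℓ ⊔ lsuc (lsuc 0ℓ))
UfKnaster {ℓ} κ P =
  ∀ (A : Pred Carrier ℓ) → A Respects _≈_ → HasSize setoid≈ A κ →
  Σ (Pred Carrier ℓ) λ B → B Respects _≈_ × B ⊆ A × HasSize setoid≈ B κ × UfLinked B
  where open ForcingPoset P
        open Forcing P

-- The full product, ordered coordinatewise.
Product : {I : Set i} → (I → ForcingPoset ℓ) → ForcingPoset (i ⊔ ℓ)
Product {I = I} P = record
  { preorder = record
    { Carrier    = ∀ j → P.Carrier j
    ; _≈_        = λ p q → ∀ j → P._≈_ j (p j) (q j)
    ; _≲_        = λ p q → ∀ j → P._≲_ j (p j) (q j)
    ; isPreorder = record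
      { isEquivalence = record
        { refl  = λ j → P.Eq.refl j
        ; sym   = λ e j → P.Eq.sym j (e j)
        ; trans = λ e f j → P.Eq.trans j (e j) (f j)
        }
      ; reflexive = λ e j → P.reflexive j (e j)
      ; trans     = λ e f j → P.trans j (e j) (f j)
      }
    }
  ; 𝟙       = λ j → P.𝟙 j
  ; maximum = λ p j → P.maximum j (p j)
  }
  where module P (j : I) = ForcingPoset (P j)

FiniteSupport : {I : Set ℓ} (P : I → ForcingPoset ℓ) → Pred (ForcingPoset.Carrier (Product P)) ℓ
FiniteSupport P p = Finite λ j → ¬ (ForcingPoset._≈_ (P j) (p j) (ForcingPoset.𝟙 (P j)))

FSProduct : {I : Set ℓ} → (I → ForcingPoset ℓ) → ForcingPoset ℓ
FSProduct P = record
  { preorder = On.preorder (ForcingPoset.preorder (Product P)) (proj₁ {B = FiniteSupport P})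
  ; 𝟙        = ForcingPoset.𝟙 (Product P) , [] , λ {j} 𝟙≉𝟙 → ⊥-elim (𝟙≉𝟙 (ForcingPoset.Eq.refl (P j)))
  ; maximum  = λ p → ForcingPoset.maximum (Product P) (proj₁ p)
  }

{-# OPTIONS --safe #-}
-- A family of κ conditions is thinned so that the supports form a Δ-system with
-- a finite root and the restrictions to the root are linked. Let ᾱ be a sequence
-- of indices. If some index β is taken F-positively often, then p_β is the
-- required condition. Otherwise the condition q obtained in the root product
-- works: given r below q, the support of r meets only finitely many of the
-- petals, so it is avoided on a set in F, and there r can be amalgamated with
-- p_(ᾱ n) as soon as the restrictions to the root are compatible. For an
-- ultrafilter, a condition r below a linking condition is compatible with p_n for
-- almost all n, and finitely many such sets intersect; hence linkedness passes
-- to finite products.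
module Submission where

open import Defs
open import Axiom.ExcludedMiddle using (ExcludedMiddle)
open import Data.Empty using (⊥-elim)
open import Data.Fin using (Fin; zero; suc)
open import Data.List using (List; []; _∷_; _++_; filter; length; tabulate)
open import Data.List.Membership.Propositional using (lose) renaming (_∈_ to _∈ₗ_)
open import Data.List.Membership.Propositional.Properties using (∈-++⁺ˡ; ∈-++⁺ʳ; ∈-filter⁺; ∈-tabulate⁺)
open import Data.List.Properties using (filter-notAll)
open import Data.List.Relation.Unary.Any using (here; there)
open import Data.Nat using (ℕ; zero; suc)
import Data.Nat as ℕ
import Data.Nat.Properties as ℕ
open import Data.Product using (Σ; ∃-syntax; _×_; _,_; proj₁; proj₂)
open import Data.Sum using (_⊎_; inj₁; inj₂)
open import Data.Unit using (⊤)
open import Function.Base using (_∘_; id)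
open import Function.Bundles using (Bijection; _↣_; Injection; mk↣)
open import Function.Definitions using (Injective)
open import Induction.WellFounded using (Acc; acc; WfRec; module All; module FixPoint)
open import Level using (Level; 0ℓ; lift; lower; _⊔_) renaming (suc to lsuc)
open import Relation.Binary.Core using (Rel)
open import Relation.Binary.Definitions using (tri<; tri≈; tri>; _Respects_)
open import Relation.Binary.PropositionalEquality using (_≡_; _≢_; refl; sym; trans; cong; subst)
open import Relation.Binary.Structures using (IsStrictTotalOrder)
open import Relation.Nullary using (¬_; Dec; yes; no; contradiction)
open import Relation.Nullary.Decidable using (True; toWitness; fromWitness; ¬?; decidable-stable)
open import Relation.Unary using (Pred; _⊆_)

open Filter using (Member; whole; proper; upward; meet)

module Classical (em : ∀ {a : Level} → ExcludedMiddle a) where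

  -- Members of filters and enumeration of finite lists.

  member-inhabited : ∀ (F : Filter) {a} → Member F a → ∃[ n ] a n
  member-inhabited F {a} a∈F with em {P = ∃[ n ] a n}
  ... | yes found = found
  ... | no  empty = ⊥-elim (proper F (upward F a∈F λ {n} n∈a → empty (n , n∈a)))

  -- Repetitions in the list are skipped, because finite subproducts are indexed by injections
  -- `Fin n ↣ I`.
  enumerate : ∀ {i} {I : Set i} (xs : List I) →
              ∃[ n ] Σ (Fin n ↣ I) λ J → ∀ {x} → x ∈ₗ xs → ∃[ k ] Injection.to J k ≡ x
  enumerate []       = 0 , mk↣ {to = λ ()} (λ { {()} }) , λ ()
  enumerate (x ∷ xs) with enumerate xs
  ... | n , J , covers with em {P = ∃[ k ] Injection.to J k ≡ x}
  ...   | yes found = n , J , λ { (here refl) → found ; (there y∈xs) → covers y∈xs }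
  ...   | no  fresh = suc n , mk↣ {to = to} injective , covers′
    where
    to : Fin (suc n) → _
    to zero    = x
    to (suc k) = Injection.to J k

    injective : Injective _≡_ _≡_ to
    injective {zero}  {zero}  _  = refl
    injective {zero}  {suc k} eq = contradiction (k , sym eq) fresh
    injective {suc k} {zero}  eq = contradiction (k , eq) fresh
    injective {suc k} {suc l} eq = cong suc (Injection.injective J eq)

    covers′ : ∀ {y} → y ∈ₗ x ∷ xs → ∃[ k ] to k ≡ y
    covers′ (here refl)  = zero , refl
    covers′ (there y∈xs) = let k , eq = covers y∈xs in suc k , eq

  -- Combinatorics of a regular uncountable cardinal

  module Regularity {ℓ} (κ : Cardinal ℓ) (regular : Regular κ) (uncountable : Uncountable κ) where
    open Cardinal κ using (_<_; wellFounded) renaming (Carrier to K)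
    open IsStrictTotalOrder (Cardinal.isStrictTotalOrder κ) using (compare; irrefl; _<?_) renaming (trans to <-trans)

    Increasing : (K → K) → Set ℓ
    Increasing e = ∀ {β α} → β < α → e β < e α

    increasing⇒injective : ∀ {e} → Increasing e → Injective _≡_ _≡_ e
    increasing⇒injective incr {α} {β} eq with compare α β
    ... | tri< α<β _ _ = contradiction (incr α<β) (irrefl eq)
    ... | tri≈ _ α≡β _ = α≡β
    ... | tri> _ _ β<α = contradiction (incr β<α) (irrefl (sym eq))

    Least : ∀ {q} → Pred K q → Pred K (ℓ ⊔ q)
    Least Q α = Q α × (∀ {β} → Q β → ¬ β < α)

    least : ∀ {q} (Q : Pred K q) → ∃[ α ] Q α → ∃[ α ] Least Q α
    least Q (α , qα) = go (wellFounded α) qα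
      where
      go : ∀ {α} → Acc _<_ α → Q α → ∃[ α ] Least Q α
      go {α} (acc rs) qα with em {P = ∃[ β ] (Q β × β < α)}
      ... | yes (β , qβ , β<α) = go (rs β<α) qβ
      ... | no  minimal        = α , qα , λ qβ β<α → minimal (_ , qβ , β<α)

    -- Two predicates are allowed because the stages compared in `next-ext` have admissibility
    -- predicates that include one another without being definitionally the same.
    least-unique : ∀ {q r} {Q : Pred K q} {R : Pred K r} → Q ⊆ R → R ⊆ Q →
                   ∀ {α β} → Least Q α → Least R β → α ≡ β
    least-unique Q⊆R R⊆Q {α} {β} (qα , minα) (rβ , minβ) with compare α β
    ... | tri< α<β _ _ = contradiction α<β (minβ (Q⊆R qα))
    ... | tri≈ _ α≡β _ = α≡β
    ... | tri> _ _ β<α = contradiction β<α (minα (R⊆Q rβ))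

    abstract
      -- Transfinite recursion of length κ, in which stage γ picks a point related to all earlier
      -- choices. The increasing, the disjoint and the pairwise inequivalent subfamilies below are
      -- instances.
      thin : ∀ {q c} (Q : Pred K q) (C : Rel K c) →
             (∀ γ (g : K → K) → ∃[ α ] (Q α × (∀ β → β < γ → C (g β) α))) →
             Σ (K → K) λ e → ((∀ α → Q (e α)) × (∀ {β α} → β < α → C (e β) (e α)))
      thin {q} {c} Q C pick = e , (λ α → proj₁ (proj₁ (e-least α))) , e-related
        where
        total : ∀ γ → WfRec _<_ (λ _ → K) γ → K → K
        total γ g β with β <? γ
        ... | yes β<γ = g β<γ
        -- A default that makes the history total, as `pick` expects; `Admissible` only inspects
        -- arguments below γ.
        ... | no  _   = γ

        total-≡ : ∀ (h : K → K) {β γ} → β < γ → total γ (λ {δ} _ → h δ) β ≡ h β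
        total-≡ h {β} {γ} β<γ with β <? γ
        ... | yes _   = refl
        ... | no  β≮γ = contradiction β<γ β≮γ

        Admissible : ∀ γ → WfRec _<_ (λ _ → K) γ → Pred K (q ⊔ ℓ ⊔ c)
        Admissible γ g α = Q α × (∀ β → β < γ → C (total γ g β) α)

        -- Taking least witnesses makes the recursion extensional in the previous values.
        chosen : ∀ γ (g : WfRec _<_ (λ _ → K) γ) → ∃[ α ] Least (Admissible γ g) α
        chosen γ g = least (Admissible γ g) (pick γ (total γ g))

        next : ∀ γ → WfRec _<_ (λ _ → K) γ → K
        next γ g = proj₁ (chosen γ g)

        total-cong : ∀ γ {g h : WfRec _<_ (λ _ → K) γ} → (∀ {β} β<γ → g {β} β<γ ≡ h β<γ) →
                     ∀ β → total γ g β ≡ total γ h β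
        total-cong γ g≗h β with β <? γ
        ... | yes β<γ = g≗h β<γ
        ... | no  _   = refl

        next-ext : ∀ γ {g h : WfRec _<_ (λ _ → K) γ} → (∀ {β} β<γ → g {β} β<γ ≡ h β<γ) → next γ g ≡ next γ h
        next-ext γ {g} {h} g≗h = least-unique
          (λ (qα , c) → qα , λ β β<γ → subst (λ x → C x _) (total-cong γ g≗h β) (c β β<γ))
          (λ (qα , c) → qα , λ β β<γ → subst (λ x → C x _) (sym (total-cong γ g≗h β)) (c β β<γ))
          (proj₂ (chosen γ g)) (proj₂ (chosen γ h))

        e : K → K
        e = All.wfRec wellFounded ℓ (λ _ → K) next

        e-least : ∀ α → Least (Admissible α (λ {β} _ → e β)) (e α)
        e-least α = subst (Least _) (sym (FixPoint.unfold-wfRec wellFounded (λ _ → K) next next-ext))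
                                    (proj₂ (chosen α (λ {β} _ → e β)))

        e-related : ∀ {β α} → β < α → C (e β) (e α)
        e-related {β} {α} β<α = subst (λ x → C x (e α)) (total-≡ e β<α)
                                      (proj₂ (proj₁ (e-least α)) β β<α)

    abstract
      -- Regularity concerns functions on proper initial segments, so a copy of ω inside such a
      -- segment is needed. Iterated successors of the least element give the copy, and by
      -- uncountability they miss some γ, which then lies above them all.
      ω-bounded : ∃[ γ ] Σ (ℕ → K) λ ι → (∀ n → ι n < γ) × Injective _≡_ _≡_ ι
      ω-bounded with em {P = K}
      ... | no  empty = ⊥-elim (uncountable (mk↣ {to = ⊥-elim ∘ empty} λ {α} _ → ⊥-elim (empty α)))
      ... | yes κ₀    = γ , ι , ι<γ , injective
        where
        next : K → K
        next α with em {P = ∃[ β ] α < β}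
        ... | yes above = proj₁ (least (α <_) above)
        ... | no  _     = α

        next-least : ∀ {α β} → α < β → Least (α <_) (next α)
        next-least {α} {β} α<β with em {P = ∃[ β ] α < β}
        ... | yes above = proj₂ (least (α <_) above)
        ... | no  none  = contradiction (β , α<β) none

        ι : ℕ → K
        ι zero    = proj₁ (least (λ _ → ⊤) (κ₀ , _))
        ι (suc n) = next (ι n)

        missed : ∃[ γ ] ¬ (∃[ n ] ι n ≡ γ)
        missed with em {P = ∃[ γ ] ¬ (∃[ n ] ι n ≡ γ)}
        ... | yes found = found
        ... | no  none  = ⊥-elim (uncountable (mk↣ {to = proj₁ ∘ index} λ {α} {β} eq →
                            trans (sym (proj₂ (index α))) (trans (cong ι eq) (proj₂ (index β)))))
          where
          index : ∀ γ → ∃[ n ] ι n ≡ γ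
          index γ = decidable-stable em λ γ∉ι → none (γ , γ∉ι)

        γ : K
        γ = proj₁ missed

        below : ∀ n → ¬ γ < ι n → ι n < γ
        below n γ≮ιn with compare (ι n) γ
        ... | tri< ιn<γ _ _ = ιn<γ
        ... | tri≈ _ ιn≡γ _ = contradiction (n , ιn≡γ) (proj₂ missed)
        ... | tri> _ _ γ<ιn = contradiction γ<ιn γ≮ιn

        ι<γ : ∀ n → ι n < γ
        ι<γ zero    = below zero (proj₂ (proj₂ (least (λ _ → ⊤) (κ₀ , _))) _)
        -- γ lies above `ι n`, so the least element above `ι n` cannot exceed γ, and it differs from
        -- γ because γ is missed.
        ι<γ (suc n) = below (suc n) (proj₂ (next-least (ι<γ n)) (ι<γ n))

        ι-increasing : ∀ {m n} → m ℕ.<′ n → ι m < ι n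
        ι-increasing {m} ℕ.<′-base       = proj₁ (next-least (ι<γ m))
        ι-increasing (ℕ.≤′-step {n} m<n) = <-trans (ι-increasing m<n) (proj₁ (next-least (ι<γ n)))

        injective : Injective _≡_ _≡_ ι
        injective {m} {n} eq with ℕ.<-cmp m n
        ... | tri< m<n _ _ = contradiction (ι-increasing (ℕ.≤⇒≤′ m<n)) (irrefl eq)
        ... | tri≈ _ m≡n _ = m≡n
        ... | tri> _ _ n<m = contradiction (ι-increasing (ℕ.≤⇒≤′ n<m)) (irrefl (sym eq))

      -- The sequence is carried along ι to a function on the segment below γ, where regularity
      -- applies; off the range of ι the values are arbitrary.
      countable-bound : ∀ (b : ℕ → K) → ∃[ β ] (∀ n → b n < β)
      countable-bound b with ω-bounded
      ... | γ , ι , ι<γ , ι-injective =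
        let β , b̂<β = regular γ b̂ in β , λ n → subst (_< β) (b̂-ι n) (b̂<β (ι n) (ι<γ n))
        where
        b̂ : K → K
        b̂ α with em {P = ∃[ n ] ι n ≡ α}
        ... | yes (n , _) = b n
        ... | no  _       = α

        b̂-ι : ∀ n → b̂ (ι n) ≡ b n
        b̂-ι n with em {P = ∃[ m ] ι m ≡ ι n}
        ... | yes (m , eq) = cong b (ι-injective eq)
        ... | no  none     = contradiction (n , refl) none

      above₂ : ∀ α β → ∃[ γ ] (α < γ × β < γ)
      above₂ α β = let γ , <γ = countable-bound (λ { zero → α ; (suc _) → β }) in γ , <γ 0 , <γ 1

    Bounded : ∀ {s} → Pred K s → Set (ℓ ⊔ s)
    Bounded S = ∃[ β ] (∀ {α} → S α → ¬ β < α)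

    -- The pigeonhole principle used throughout: the choices made before stage γ have a bound by
    -- regularity, and an unbounded set has an element beyond it.
    bounded-or-increasing : ∀ {s} (S : Pred K s) → Bounded S ⊎ (Σ (K → K) λ e → ((∀ α → S (e α)) × Increasing e))
    bounded-or-increasing S with em {P = Bounded S}
    ... | yes bounded  = inj₁ bounded
    ... | no unbounded = inj₂ (thin S _<_ λ γ g →
          let δ , g<δ        = regular γ g
              α , α∈S , δ<α = beyond δ
          in  α , α∈S , λ β β<γ → <-trans (g<δ β β<γ) δ<α)
      where
      beyond : ∀ δ → ∃[ α ] (S α × δ < α)
      beyond δ = decidable-stable em λ none → unbounded (δ , λ α∈S δ<α → none (_ , α∈S , δ<α))

    -- Weaker than the usual notion: pairwise intersections are only contained in the root.
    Δ-System : ∀ {i} {I : Set i} → List I → (K → List I) → Set (ℓ ⊔ i)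
    Δ-System R f = ∀ {β α} → β ≢ α → ∀ {j} → j ∈ₗ f β → j ∈ₗ f α → j ∈ₗ R

    Δ-system-< : ∀ {i} {I : Set i} {R : List I} {f : K → List I} →
                 (∀ {β α} → β < α → ∀ {j} → j ∈ₗ f β → j ∈ₗ f α → j ∈ₗ R) → Δ-System R f
    Δ-system-< related {β} {α} β≢α j∈β j∈α with compare β α
    ... | tri< β<α _ _ = related β<α j∈β j∈α
    ... | tri≈ _ β≡α _ = contradiction β≡α β≢α
    ... | tri> _ _ α<β = related α<β j∈α j∈β

    -- Δ-systems of finite lists.

    module _ {i} {I : Set i} where

      -- Each entry of an earlier list disappears from the family beyond some index. Regularity
      -- bounds these indices simultaneously, so any larger index gives a list disjoint from all
      -- earlier ones.
      disjoint-subfamily : (f : K → List I) → (∀ j → Bounded (λ α → j ∈ₗ f α)) →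
                           Σ (K → K) λ e → (Increasing e × Δ-System [] (f ∘ e))
      disjoint-subfamily f bounded =
        let e , _ , related = thin (λ _ → ⊤) C pick
        in  e , (λ β<α → proj₁ (related β<α)) ,
            Δ-system-< λ β<α j∈β j∈α → ⊥-elim (proj₂ (related β<α) j∈β j∈α)
        where
        C : Rel K (ℓ ⊔ i)
        C β α = β < α × (∀ {j} → j ∈ₗ f β → ¬ j ∈ₗ f α)

        bound : (xs : List I) → ∃[ β ] (∀ {j} → j ∈ₗ xs → ∀ {α} → β < α → ¬ j ∈ₗ f α)
        -- Any element of κ would do here; `ω-bounded` supplies one.
        bound []       = proj₁ ω-bounded , λ ()
        bound (x ∷ xs) =
          let β , far  = bound xs
              γ , far′ = bounded x
              δ , β<δ , γ<δ = above₂ β γ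
          in  δ , λ { (here refl)  δ<α x∈α → far′ x∈α (<-trans γ<δ δ<α)
                    ; (there j∈xs) δ<α     → far j∈xs (<-trans β<δ δ<α) }

        pick : ∀ γ (g : K → K) → ∃[ α ] (⊤ × (∀ β → β < γ → C (g β) α))
        pick γ g =
          let δ , g<δ = regular γ g
              ε , b<ε = regular γ (λ β → proj₁ (bound (f (g β))))
              α , δ<α , ε<α = above₂ δ ε
          in  α , _ , λ β β<γ → <-trans (g<δ β β<γ) δ<α ,
                                λ j∈ → proj₂ (bound (f (g β))) j∈ (<-trans (b<ε β β<γ) ε<α)

      -- Induction on the length bound. If some entry x occurs at unboundedly many indices, pass to
      -- those, delete x from every list, which shortens it, and put x into the root.
      Δ-lemma-bounded : ∀ n (f : K → List I) → (∀ α → length (f α) ℕ.≤ n) →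
                        Σ (K → K) λ e → (Increasing e × ∃[ R ] Δ-System R (f ∘ e))
      Δ-lemma-bounded n f short with em {P = ∀ j → Bounded (λ α → j ∈ₗ f α)}
      ... | yes bounded = let e , incr , Δ = disjoint-subfamily f bounded in e , incr , [] , Δ
      ... | no  ¬bounded = split n short
        where
        popular : ∃[ j ] Σ (K → K) λ e → ((∀ α → j ∈ₗ f (e α)) × Increasing e)
        popular = decidable-stable em λ none → ¬bounded λ j → bounded none j
          where
          bounded : ¬ (∃[ j ] Σ (K → K) λ e → ((∀ α → j ∈ₗ f (e α)) × Increasing e)) →
                    ∀ j → Bounded (λ α → j ∈ₗ f α)
          bounded none j with bounded-or-increasing (λ α → j ∈ₗ f α)
          ... | inj₁ b           = b
          ... | inj₂ increasing = contradiction (j , increasing) none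

        x = proj₁ popular
        e₁ = proj₁ (proj₂ popular)
        x∈ = proj₁ (proj₂ (proj₂ popular))

        ≢x? : ∀ j → Dec (j ≢ x)
        ≢x? j = ¬? em

        f′ : K → List I
        f′ α = filter ≢x? (f (e₁ α))

        shorter : ∀ α → length (f′ α) ℕ.< length (f (e₁ α))
        shorter α = filter-notAll ≢x? (f (e₁ α)) (lose (x∈ α) λ x≢x → x≢x refl)

        split : ∀ n → (∀ α → length (f α) ℕ.≤ n) → Σ (K → K) λ e → (Increasing e × ∃[ R ] Δ-System R (f ∘ e))
        split zero    short = ⊥-elim (ℕ.n≮0 (ℕ.<-≤-trans (shorter α₀) (short (e₁ α₀))))
          where α₀ = proj₁ ω-bounded
        split (suc n) short =
          let e , incr , R , Δ = Δ-lemma-bounded n f′ λ α → ℕ.≤-pred (ℕ.<-≤-trans (shorter α) (short (e₁ α)))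
          in  e₁ ∘ e , proj₂ (proj₂ (proj₂ popular)) ∘ incr , x ∷ R , λ β≢α → extend (Δ β≢α)
          where
          extend : ∀ {R xs ys} → (∀ {j} → j ∈ₗ filter ≢x? xs → j ∈ₗ filter ≢x? ys → j ∈ₗ R) →
                   ∀ {j} → j ∈ₗ xs → j ∈ₗ ys → j ∈ₗ x ∷ R
          extend meets {j} j∈xs j∈ys with em {P = j ≡ x}
          ... | yes j≡x = here j≡x
          ... | no  j≢x = there (meets (∈-filter⁺ ≢x? j∈xs j≢x) (∈-filter⁺ ≢x? j∈ys j≢x))

      -- Some length bound holds on an unbounded set of indices. Otherwise each n has a bound on the
      -- indices of lists of length at most n, and an index β above these countably many bounds
      -- contradicts the bound for the length of its own list.
      Δ-lemma : (f : K → List I) → Σ (K → K) λ e → (Increasing e × ∃[ R ] Δ-System R (f ∘ e))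
      Δ-lemma f with em {P = ∀ n → Bounded (λ α → length (f α) ℕ.≤ n)}
      ... | yes bounded = ⊥-elim (proj₂ (bounded (length (f β))) ℕ.≤-refl (b<β (length (f β))))
        where
        β = proj₁ (countable-bound (proj₁ ∘ bounded))
        b<β = proj₂ (countable-bound (proj₁ ∘ bounded))
      ... | no ¬bounded =
        let n , e , short , incr      = popular
            e′ , incr′ , R , Δ = Δ-lemma-bounded n (f ∘ e) short
        in  e ∘ e′ , incr ∘ incr′ , R , Δ
        where
        Popular = ∃[ n ] Σ (K → K) λ e → ((∀ α → length (f (e α)) ℕ.≤ n) × Increasing e)

        bounded : ¬ Popular → ∀ n → Bounded (λ α → length (f α) ℕ.≤ n)
        bounded none n with bounded-or-increasing (λ α → length (f α) ℕ.≤ n)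
        ... | inj₁ b          = b
        ... | inj₂ increasing = contradiction (n , increasing) none

        popular : Popular
        popular = decidable-stable em λ none → ¬bounded (bounded none)

    -- Linkedness along sequences indexed by κ

    image : (P : ForcingPoset ℓ) → (K → ForcingPoset.Carrier P) → Pred (ForcingPoset.Carrier P) ℓ
    image P p x = ∃[ ξ ] ForcingPoset._≈_ P x (p ξ)

    image-respects : ∀ P p → image P p Respects ForcingPoset._≈_ P
    image-respects P p x≈y (ξ , x≈p) = ξ , P.Eq.trans (P.Eq.sym x≈y) x≈p
      where module P = ForcingPoset P

    image-size : ∀ P {p} → Injective _≡_ (ForcingPoset._≈_ P) p →
                 HasSize (ForcingPoset.setoid≈ P) (image P p) κ
    image-size P {p} injective = record
      { to        = λ ξ → p ξ , ξ , P.Eq.refl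
      ; cong      = λ { refl → P.Eq.refl }
      ; bijective = injective , λ (x , ξ , x≈p) → ξ , λ { refl → P.Eq.sym x≈p }
      }
      where module P = ForcingPoset P

    module _ (P : ForcingPoset ℓ) where
      open ForcingPoset P using (Carrier; _≈_; _≲_; module Eq)
        renaming (refl to ≲-refl; trans to ≲-trans; reflexive to ≲-reflexive)
      open Forcing P

      -- The combinatorial content of `q ⊩ Ẇ p̄ ∈̇ F ⁺`, with membership in the generic filter
      -- replaced by being above the extension s.
      ForcesPositive : Filter → Carrier → (ℕ → Carrier) → Set (ℓ ⊔ lsuc 0ℓ)
      ForcesPositive F q p̄ = ∀ {a} → Member F a → ∀ r → r ≲ q → ∃[ s ] (s ≲ r × (∃[ n ] (a n × s ≲ p̄ n)))

      ⊩⇒positive : ∀ F {q} p̄ → q ⊩ Ẇ p̄ ∈̇ F ⁺ → ForcesPositive F q p̄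
      ⊩⇒positive F p̄ q⊩ a∈F r r≲q =
        let s , s≲r , (n , n∈a) , s⊩ = q⊩ (_ , a∈F) r r≲q
            -- Forcing `p̄ n ∈Ġ` only says that conditions below `p̄ n` are dense below s, so one
            -- more extension is taken.
            s′ , s′≲s , s′≲p         = lower s⊩ s ≲-refl
        in  s′ , ≲-trans s′≲s s≲r , n , n∈a , s′≲p

      positive⇒⊩ : ∀ F {q} p̄ → ForcesPositive F q p̄ → q ⊩ Ẇ p̄ ∈̇ F ⁺
      positive⇒⊩ F p̄ positive (_ , a∈F) r r≲q =
        let s , s≲r , n , n∈a , s≲p = positive a∈F r r≲q
        in  s , s≲r , (n , n∈a) , lift λ s′ s′≲s → s′ , ≲-refl , ≲-trans s′≲s s≲p

      -- Indexing by κ lets values repeat, as restrictions to a root may do, and linkedness passes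
      -- to subsequences by reindexing ᾱ.
      SequenceLinked : Filter → (K → Carrier) → Set (ℓ ⊔ lsuc 0ℓ)
      SequenceLinked F p = ∀ (ᾱ : ℕ → K) → ∃[ q ] ForcesPositive F q (p ∘ ᾱ)

      linked⇒sequenceLinked : ∀ F B {p} → Linked F B → (h : K → Carrier) →
                              (∀ ξ → B (h ξ)) → (∀ ξ → h ξ ≈ p ξ) → SequenceLinked F p
      linked⇒sequenceLinked F B linked h h∈B h≈p ᾱ =
        let q , q⊩ = linked (h ∘ ᾱ) (h∈B ∘ ᾱ)
        in  q , λ a∈F r r≲q →
            let s , s≲r , n , n∈a , s≲h = ⊩⇒positive F (h ∘ ᾱ) q⊩ a∈F r r≲q
            in  s , s≲r , n , n∈a , ≲-trans s≲h (≲-reflexive (h≈p (ᾱ n)))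

      sequenceLinked⇒linked : ∀ F {p} → SequenceLinked F p → Linked F (image P p)
      sequenceLinked⇒linked F linked p̄ p̄∈ =
        let q , positive = linked (proj₁ ∘ p̄∈)
        in  q , positive⇒⊩ F p̄ λ a∈F r r≲q →
            let s , s≲r , n , n∈a , s≲p = positive a∈F r r≲q
            in  s , s≲r , n , n∈a , ≲-trans s≲p (≲-reflexive (Eq.sym (proj₂ (p̄∈ n))))

      constant-sequenceLinked : ∀ F {p x} → (∀ ξ → p ξ ≈ x) → SequenceLinked F p
      constant-sequenceLinked F {x = x} p≈x ᾱ = x , λ a∈F r r≲x →
        let n , n∈a = member-inhabited F a∈F
        in  r , ≲-refl , n , n∈a , ≲-trans r≲x (≲-reflexive (Eq.sym (p≈x (ᾱ n))))

    -- Compatibility under an ultrafilter.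

    meet-finite : ∀ (F : Filter) {n} {A : Fin n → Pred ℕ 0ℓ} → (∀ k → Member F (A k)) →
                  Member F (λ m → ∀ k → A k m)
    meet-finite F {zero}  A∈F = upward F (whole F) λ _ ()
    meet-finite F {suc n} A∈F =
      upward F (meet F (A∈F zero) (meet-finite F (A∈F ∘ suc))) λ (a , as) → λ { zero → a ; (suc k) → as k }

    -- Passing through True brings the compatibility set down to Pred ℕ 0ℓ.
    Compatible : (P : ForcingPoset ℓ) → ForcingPoset.Carrier P → ForcingPoset.Carrier P → Set
    Compatible P r p = True (em {P = ∃[ s ] (s P.≲ r × s P.≲ p)})
      where module P = ForcingPoset P

    -- If the complement were in F, positivity below r would give an n in it together with a common
    -- extension of r and `p̄ n`.
    compatible-member : ∀ F → IsUltrafilter F → ∀ P {q p̄ r} → ForcesPositive P F q p̄ → ForcingPoset._≲_ P r q →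
                        Member F (λ n → Compatible P r (p̄ n))
    compatible-member F ultra P {q} {p̄} {r} positive r≲q with ultra (λ n → Compatible P r (p̄ n))
    ... | inj₁ A∈F = A∈F
    ... | inj₂ ∁A∈F =
      let s , s≲r , n , n∉A , s≲p = positive ∁A∈F r r≲q
      in  contradiction (fromWitness (s , s≲r , s≲p)) n∉A

    -- One filter gives Knaster, the family of all non-principal ultrafilters UfKnaster.
    module Family {t} {T : Set t} (Fs : T → Filter) where

      FamilyKnaster : ForcingPoset ℓ → Set (lsuc ℓ ⊔ lsuc 0ℓ ⊔ t)
      FamilyKnaster P =
        ∀ (A : Pred Carrier ℓ) → A Respects _≈_ → HasSize setoid≈ A κ →
        Σ (Pred Carrier ℓ) λ B → B Respects _≈_ × B ⊆ A × HasSize setoid≈ B κ × (∀ t → Forcing.Linked P (Fs t) B)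
        where open ForcingPoset P

      -- The family p may have repetitions. The subsequence is only asked to be injective, since the
      -- bijections in `HasSize` do not respect the order of κ.
      SequenceKnaster : ForcingPoset ℓ → Set (ℓ ⊔ lsuc 0ℓ ⊔ t)
      SequenceKnaster P = ∀ (p : K → ForcingPoset.Carrier P) →
        Σ (K → K) λ e → (Injective _≡_ _≡_ e × (∀ t → SequenceLinked P (Fs t) (p ∘ e)))

      sequence⇒knaster : ∀ P → SequenceKnaster P → FamilyKnaster P
      sequence⇒knaster P seq A A-resp size =
        let e , e-injective , linked = seq p
        in  image P (p ∘ e) , image-respects P (p ∘ e) ,
            (λ (ξ , x≈p) → A-resp (P.Eq.sym x≈p) (proj₂ (size.to (e ξ)))) ,
            image-size P (e-injective ∘ size.injective) ,
            λ t → sequenceLinked⇒linked P (Fs t) (linked t)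
        where
        module P = ForcingPoset P
        module size = Bijection size
        p : K → P.Carrier
        p = proj₁ ∘ size.to

      -- Each element of the linked set B is equivalent to some value of p; inequivalent elements
      -- have different indices, so an enumeration of B yields an injective u.
      linked-subsequence : ∀ P → FamilyKnaster P → (p : K → ForcingPoset.Carrier P) →
                           Injective _≡_ (ForcingPoset._≈_ P) p →
                           Σ (K → K) λ u → (Injective _≡_ _≡_ u × (∀ t → SequenceLinked P (Fs t) (p ∘ u)))
      linked-subsequence P knaster p injective
        with knaster (image P p) (image-respects P p) (image-size P injective)
      ... | B , _ , B⊆ , size , linked = u , u-injective , λ t → linked⇒sequenceLinked P (Fs t) B (linked t) h h∈B h≈p
        where
        module P = ForcingPoset P
        module size = Bijection size

        h : K → P.Carrier
        h = proj₁ ∘ size.to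

        h∈B : ∀ ξ → B (h ξ)
        h∈B = proj₂ ∘ size.to

        u : K → K
        u ξ = proj₁ (B⊆ (h∈B ξ))

        h≈p : ∀ ξ → h ξ P.≈ p (u ξ)
        h≈p ξ = proj₂ (B⊆ (h∈B ξ))

        u-injective : Injective _≡_ _≡_ u
        u-injective {ξ} {η} eq = size.injective (P.Eq.trans (h≈p ξ)
          (P.Eq.trans (P.Eq.reflexive (cong p eq)) (P.Eq.sym (h≈p η))))

      distinct-subsequence : ∀ (P : ForcingPoset ℓ) (let module P = ForcingPoset P) (p : K → P.Carrier) →
                             (∀ γ → Bounded (λ α → p α P.≈ p γ)) →
                             Σ (K → K) λ e → (Increasing e × Injective _≡_ P._≈_ (p ∘ e))
      distinct-subsequence P p bounded with thin (λ _ → ⊤) C pick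
        where
        module P = ForcingPoset P

        C : Rel K ℓ
        C β α = β < α × ¬ p β P.≈ p α

        pick : ∀ γ (g : K → K) → ∃[ α ] (⊤ × (∀ β → β < γ → C (g β) α))
        pick γ g =
          let δ , g<δ = regular γ g
              ε , b<ε = regular γ (λ β → proj₁ (bounded (g β)))
              α , δ<α , ε<α = above₂ δ ε
          in  α , _ , λ β β<γ → <-trans (g<δ β β<γ) δ<α ,
                                λ pg≈p → proj₂ (bounded (g β)) (P.Eq.sym pg≈p) (<-trans (b<ε β β<γ) ε<α)
      ... | e , _ , related = e , (λ β<α → proj₁ (related β<α)) , injective
        where
        module P = ForcingPoset P

        injective : Injective _≡_ P._≈_ (p ∘ e)
        injective {α} {β} eq with compare α β
        ... | tri< α<β _ _ = contradiction eq (proj₂ (related α<β))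
        ... | tri≈ _ α≡β _ = α≡β
        ... | tri> _ _ β<α = contradiction (P.Eq.sym eq) (proj₂ (related β<α))

      -- Either one value recurs unboundedly often, and a constant subsequence is linked, or every
      -- value recurs boundedly, and the Knaster property applies to a subsequence of pairwise
      -- inequivalent values.
      knaster⇒sequence : ∀ P → FamilyKnaster P → SequenceKnaster P
      knaster⇒sequence P knaster p = cases em
        where
        module P = ForcingPoset P
        AllBounded = ∀ γ → Bounded (λ α → p α P.≈ p γ)
        Popular = ∃[ γ ] Σ (K → K) λ e → ((∀ α → p (e α) P.≈ p γ) × Increasing e)

        bounded : ¬ Popular → AllBounded
        bounded none γ with bounded-or-increasing (λ α → p α P.≈ p γ)
        ... | inj₁ b          = b
        ... | inj₂ increasing = contradiction (γ , increasing) none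

        cases : Dec Popular → Σ (K → K) λ e → (Injective _≡_ _≡_ e × (∀ t → SequenceLinked P (Fs t) (p ∘ e)))
        cases (yes (γ , e , p≈pγ , incr)) =
          e , increasing⇒injective incr , λ t → constant-sequenceLinked P (Fs t) p≈pγ
        cases (no none) with distinct-subsequence P p (bounded none)
        ... | e , incr , distinct with linked-subsequence P knaster (p ∘ e) distinct
        ...   | u , u-injective , linked = e ∘ u , (λ eq → u-injective (increasing⇒injective incr eq)) , linked

      -- Finite support products

      module _ {I : Set ℓ} (P : I → ForcingPoset ℓ) where
        module P (j : I) = ForcingPoset (P j)
        module FS = ForcingPoset (FSProduct P)

        -- The list witnessing finite support; it may also contain coordinates at which the
        -- condition is trivial.
        support : FS.Carrier → List I
        support (_ , xs , _) = xs

        -- Fills the trivial coordinates of r with those of p. The result always extends r, and it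
        -- extends p wherever the supports do not overlap.
        patch : FS.Carrier → FS.Carrier → FS.Carrier
        patch (r , xs , r-supports) (p , ys , p-supports) = value , xs ++ ys , λ {j} → supports j
          where
          value : ∀ j → P.Carrier j
          value j with em {P = P._≈_ j (r j) (P.𝟙 j)}
          ... | yes _ = p j
          ... | no  _ = r j

          supports : ∀ j → ¬ P._≈_ j (value j) (P.𝟙 j) → j ∈ₗ xs ++ ys
          supports j v≉𝟙 with em {P = P._≈_ j (r j) (P.𝟙 j)}
          ... | yes _    = ∈-++⁺ʳ xs (p-supports v≉𝟙)
          ... | no  rj≉𝟙 = ∈-++⁺ˡ (r-supports rj≉𝟙)

        patch-≲ˡ : ∀ r p → patch r p FS.≲ r
        patch-≲ˡ (r , _) (p , _) j with em {P = P._≈_ j (r j) (P.𝟙 j)}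
        ... | yes rj≈𝟙 = P.trans j (P.maximum j (p j)) (P.reflexive j (P.Eq.sym j rj≈𝟙))
        ... | no  _    = P.refl j

        patch-≲ʳ : ∀ r p j → (j ∈ₗ support r → ¬ j ∈ₗ support p) → P._≲_ j (proj₁ (patch r p) j) (proj₁ p j)
        patch-≲ʳ (r , _ , r-supports) (p , _ , p-supports) j apart with em {P = P._≈_ j (r j) (P.𝟙 j)}
        ... | yes _    = P.refl j
        ... | no  rj≉𝟙 = P.trans j (P.maximum j (r j)) (P.reflexive j (P.Eq.sym j pj≈𝟙))
          where
          pj≈𝟙 : P._≈_ j (p j) (P.𝟙 j)
          pj≈𝟙 = decidable-stable em λ pj≉𝟙 → apart (r-supports rj≉𝟙) (p-supports pj≉𝟙)

        module Root {n} (J : Fin n ↣ I) where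
          open Injection J using (injective) renaming (to to index)

          PJ : ForcingPoset ℓ
          PJ = Product (P ∘ index)
          module PJ = ForcingPoset PJ

          restrict : FS.Carrier → PJ.Carrier
          restrict (p , _) k = p (index k)

          override : (∀ j → P.Carrier j) → PJ.Carrier → ∀ j → P.Carrier j
          override p s j with em {P = ∃[ k ] index k ≡ j}
          ... | yes (k , eq) = subst P.Carrier eq (s k)
          ... | no  _        = p j

          override-index : ∀ p s k → override p s (index k) ≡ s k
          override-index p s k with em {P = ∃[ l ] index l ≡ index k}
          ... | no  none = contradiction (k , refl) none
          -- Excluded middle may return any preimage of `index k`; injectivity identifies it with k,
          -- and the remaining loop is reflexivity by axiom K.
          ... | yes (l , eq) with injective eq
          ...   | refl with eq
          ...     | refl = refl

          override-elim : ∀ {c} p s (C : ∀ j → P.Carrier j → Set c) →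
                          (∀ k → C (index k) (s k)) → (∀ j → ¬ (∃[ k ] index k ≡ j) → C j (p j)) →
                          ∀ j → C j (override p s j)
          override-elim p s C on off j with em {P = ∃[ k ] index k ≡ j}
          ... | yes (k , refl) = on k
          ... | no  j∉J        = off j j∉J

          override-finite : ∀ {p} s → FiniteSupport P p → FiniteSupport P (override p s)
          override-finite {p} s (xs , supports) = tabulate index ++ xs , λ {j} →
            override-elim p s (λ j x → ¬ P._≈_ j x (P.𝟙 j) → j ∈ₗ tabulate index ++ xs)
              (λ k _ → ∈-++⁺ˡ (∈-tabulate⁺ k)) (λ j _ pj≉𝟙 → ∈-++⁺ʳ (tabulate index) (supports pj≉𝟙)) j

          infixl 6 _◁_
          _◁_ : FS.Carrier → PJ.Carrier → FS.Carrier
          (p , finite) ◁ s = override p s , override-finite s finite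

          restrict-below : ∀ {r p s} → r FS.≲ p ◁ s → restrict r PJ.≲ s
          restrict-below {r} {p} {s} r≲ k =
            subst (P._≲_ (index k) (proj₁ r (index k))) (override-index (proj₁ p) s k) (r≲ (index k))

          -- On the root s lies below both conditions; elsewhere the supports are disjoint, so
          -- `patch` is a common extension.
          amalgamate : ∀ r p s → s PJ.≲ restrict r → s PJ.≲ restrict p →
                       (∀ {j} → j ∈ₗ support r → ¬ (∃[ k ] index k ≡ j) → ¬ j ∈ₗ support p) →
                       ∃[ u ] (u FS.≲ r × u FS.≲ p)
          amalgamate r p s s≲r s≲p apart =
            (patch r p ◁ s) ,
            override-elim _ s (λ j x → P._≲_ j x (proj₁ r j)) s≲r (λ j _ → patch-≲ˡ r p j) ,
            override-elim _ s (λ j x → P._≲_ j x (proj₁ p j)) s≲p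
              (λ j j∉J → patch-≲ʳ r p j (λ j∈r → apart j∈r j∉J))

          -- The Δ-system separates only distinct indices, whereas ᾱ may repeat one; hence the case
          -- distinction on an index taken F-positively often.
          root-linked : ∀ F (x : K → FS.Carrier) {R} → Δ-System R (support ∘ x) →
                        (∀ {j} → j ∈ₗ R → ∃[ k ] index k ≡ j) →
                        SequenceLinked PJ F (restrict ∘ x) → SequenceLinked (FSProduct P) F x
          root-linked F x Δ R⊆J linked ᾱ
            with em {P = ∃[ β ] (∀ a → Member F a → ∃[ n ] (a n × ᾱ n ≡ β))}
          ... | yes (β , hit) = x β , λ {a} a∈F r r≲xβ →
            let n , n∈a , eq = hit a a∈F
            in  r , FS.refl {r} , n , n∈a , subst (λ ξ → r FS.≲ x ξ) (sym eq) r≲xβ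
          ... | no miss =
            let q , positive = linked ᾱ
            -- Being trivial off the root, this condition constrains r only through its restriction
            -- to the root. The set b makes the supports of r and `x (ᾱ n)` disjoint off the root.
            in  FS.𝟙 ◁ q , λ a∈F r r≲q →
                let b , b∈F , apart = avoid-all (support r)
                    s , s≲r , n , (n∈a , n∈b) , s≲x =
                      positive (meet F a∈F b∈F) (restrict r) (restrict-below {r} {FS.𝟙} r≲q)
                    u , u≲r , u≲x = amalgamate r (x (ᾱ n)) s s≲r s≲x (apart n n∈b)
                in  u , u≲r , n , n∈a , u≲x
            where
            avoid : ∀ β → ∃[ a ] (Member F a × (∀ n → a n → ᾱ n ≢ β))
            avoid β = decidable-stable em λ none → miss (β , λ a a∈F →
              decidable-stable em λ never → none (a , a∈F , λ n n∈a eq → never (n , n∈a , eq)))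

            -- Outside the root each coordinate lies in at most one of the supports.
            avoid-coordinate : ∀ j → ¬ (∃[ k ] index k ≡ j) →
                               ∃[ a ] (Member F a × (∀ n → a n → ¬ j ∈ₗ support (x (ᾱ n))))
            avoid-coordinate j j∉J with em {P = ∃[ β ] j ∈ₗ support (x β)}
            ... | no  none      = _ , whole F , λ n _ j∈ → none (ᾱ n , j∈)
            ... | yes (β , j∈β) =
              let a , a∈F , ≢β = avoid β
              in  a , a∈F , λ n n∈a j∈ → j∉J (R⊆J (Δ (≢β n n∈a) j∈ j∈β))

            avoid-all : ∀ xs → ∃[ a ] (Member F a × (∀ n → a n → ∀ {j} → j ∈ₗ xs →
                        ¬ (∃[ k ] index k ≡ j) → ¬ j ∈ₗ support (x (ᾱ n))))
            avoid-all []       = _ , whole F , λ _ _ ()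
            avoid-all (y ∷ ys) with avoid-all ys | em {P = ∃[ k ] index k ≡ y}
            ... | a , a∈F , apart | yes y∈J = a , a∈F , λ
              { n n∈a (here refl) y∉J → contradiction y∈J y∉J ; n n∈a (there j∈ys) → apart n n∈a j∈ys }
            ... | a , a∈F , apart | no y∉J =
              let b , b∈F , y-apart = avoid-coordinate y y∉J
              in  _ , meet F a∈F b∈F , λ
                { n (_ , n∈b) (here refl) _ → y-apart n n∈b ; n (n∈a , _) (there j∈ys) → apart n n∈a j∈ys }

        fsProduct-sequenceKnaster : (∀ {n} (J : Fin n ↣ I) → SequenceKnaster (Product (P ∘ Injection.to J))) →
                                    SequenceKnaster (FSProduct P)
        fsProduct-sequenceKnaster knaster p =
          let e , incr , R , Δ         = Δ-lemma (support ∘ p)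
              n , J , R⊆J              = enumerate R
              e′ , e′-injective , linked = knaster J (Root.restrict J ∘ p ∘ e)
          in  e ∘ e′ , e′-injective ∘ increasing⇒injective incr ,
              λ t → Root.root-linked J (Fs t) (p ∘ e ∘ e′) (λ β≢α → Δ (β≢α ∘ e′-injective)) R⊆J (linked t)

      -- Finite products under ultrafilters

      -- The coordinates are thinned one after another; earlier ones stay linked because a sequence
      -- of indices can be composed with the new injection.
      simultaneous : ∀ {n} (P : Fin n → ForcingPoset ℓ) → (∀ k → SequenceKnaster (P k)) →
                     (p : ∀ k → K → ForcingPoset.Carrier (P k)) →
                     Σ (K → K) λ e → (Injective _≡_ _≡_ e × (∀ k t → SequenceLinked (P k) (Fs t) (p k ∘ e)))
      simultaneous {zero}  P knaster p = id , id , λ ()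
      simultaneous {suc n} P knaster p =
        let e , e-injective , linked    = simultaneous (P ∘ suc) (knaster ∘ suc) (p ∘ suc)
            e′ , e′-injective , linked₀ = knaster zero (p zero ∘ e)
        in  e ∘ e′ , e′-injective ∘ e-injective ,
            λ { zero t → linked₀ t ; (suc k) t ᾱ → linked k t (e′ ∘ ᾱ) }

      finiteProduct-sequenceKnaster : (∀ t → IsUltrafilter (Fs t)) →
                                      ∀ {n} (P : Fin n → ForcingPoset ℓ) → (∀ k → SequenceKnaster (P k)) →
                                      SequenceKnaster (Product P)
      finiteProduct-sequenceKnaster ultra P knaster p =
        let e , e-injective , linked = simultaneous P knaster (λ k ξ → p ξ k)
        in  e , e-injective , λ t ᾱ →
            (λ k → proj₁ (linked k t ᾱ)) , λ a∈F r r≲q →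
            -- A single n in a serves all coordinates at once, so the coordinatewise common
            -- extensions assemble into one condition below r and `p (e (ᾱ n))`.
            let n , n∈a , compatible = member-inhabited (Fs t) (meet (Fs t) a∈F (meet-finite (Fs t) λ k →
                  compatible-member (Fs t) (ultra t) (P k) (proj₂ (linked k t ᾱ)) (r≲q k)))
                s = λ k → toWitness (compatible k)
            in  (λ k → proj₁ (s k)) , (λ k → proj₁ (proj₂ (s k))) , n , n∈a , λ k → proj₂ (proj₂ (s k))

      fsProduct-knaster : ∀ {I : Set ℓ} (P : I → ForcingPoset ℓ) →
                          (∀ {n} (J : Fin n ↣ I) → FamilyKnaster (Product (P ∘ Injection.to J))) →
                          FamilyKnaster (FSProduct P)
      fsProduct-knaster P knaster = sequence⇒knaster (FSProduct P)
        (fsProduct-sequenceKnaster P λ J → knaster⇒sequence (Product (P ∘ Injection.to J)) (knaster J))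

      fsProduct-ultra-knaster : (∀ t → IsUltrafilter (Fs t)) → ∀ {I : Set ℓ} (P : I → ForcingPoset ℓ) →
                                (∀ j → FamilyKnaster (P j)) → FamilyKnaster (FSProduct P)
      fsProduct-ultra-knaster ultra P knaster = sequence⇒knaster (FSProduct P)
        (fsProduct-sequenceKnaster P λ J → finiteProduct-sequenceKnaster ultra (P ∘ Injection.to J)
          λ k → knaster⇒sequence (P (Injection.to J k)) (knaster (Injection.to J k)))

-- Single filters and the family of all non-principal ultrafilters.

theorem3p21 : (∀ {a : Level} → ExcludedMiddle a) →
    ∀ {ℓ : Level} (κ : Cardinal ℓ) → Regular κ → Uncountable κ →
    (∀ (F : Filter) → Free F →
    ∀ {I : Set ℓ} (P : I → ForcingPoset ℓ) →
    (∀ {n : ℕ} (J : Fin n ↣ I) → Knaster κ F (Product (λ k → P (Injection.to J k)))) →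
    Knaster κ F (FSProduct P))
    ×
    (∀ (F : Filter) → Free F → IsUltrafilter F →
    ∀ {I : Set ℓ} (P : I → ForcingPoset ℓ) →
    (∀ j → Knaster κ F (P j)) →
    Knaster κ F (FSProduct P))
    ×
    (∀ {I : Set ℓ} (P : I → ForcingPoset ℓ) →
    (∀ j → UfKnaster κ (P j)) →
    UfKnaster κ (FSProduct P))
theorem3p21 em {ℓ} κ regular uncountable =
  (λ F _ P knaster → fromFamily F (FSProduct P) (Family.fsProduct-knaster (constantly F) P
    λ J → toFamily F (Product (λ k → P (Injection.to J k))) (knaster J))) ,
  (λ F _ ultra P knaster → fromFamily F (FSProduct P) (Family.fsProduct-ultra-knaster (constantly F) (λ _ → ultra) P
    λ j → toFamily F (P j) (knaster j))) ,
  (λ P knaster → fromUfFamily (FSProduct P) (Family.fsProduct-ultra-knaster underlying (proj₁ ∘ proj₂) P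
    λ j → toUfFamily (P j) (knaster j)))
  where
  open Classical em
  open Regularity κ regular uncountable

  constantly : Filter → ⊤ → Filter
  constantly F _ = F

  underlying : Σ Filter (λ D → IsUltrafilter D × ¬ Principal D) → Filter
  underlying = proj₁

  toFamily : ∀ F P → Knaster κ F P → Family.FamilyKnaster (constantly F) P
  toFamily F P knaster A A-resp size =
    let B , B-resp , B⊆A , B-size , linked = knaster A A-resp size
    in  B , B-resp , B⊆A , B-size , λ _ → linked

  fromFamily : ∀ F P → Family.FamilyKnaster (constantly F) P → Knaster κ F P
  fromFamily F P knaster A A-resp size =
    let B , B-resp , B⊆A , B-size , linked = knaster A A-resp size
    in  B , B-resp , B⊆A , B-size , linked _

  toUfFamily : ∀ P → UfKnaster κ P → Family.FamilyKnaster underlying P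
  toUfFamily P knaster A A-resp size =
    let B , B-resp , B⊆A , B-size , linked = knaster A A-resp size
    in  B , B-resp , B⊆A , B-size , λ (D , ultra , nonprincipal) → linked D ultra nonprincipal

  fromUfFamily : ∀ P → Family.FamilyKnaster underlying P → UfKnaster κ P
  fromUfFamily P knaster A A-resp size =
    let B , B-resp , B⊆A , B-size , linked = knaster A A-resp size
    in  B , B-resp , B⊆A , B-size , λ D ultra nonprincipal → linked (D , ultra , nonprincipal)
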